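{- The categories $\mathsf{Dial}_M(\mathsf{Set})$, for $M$ a biclosed poset, form a sound and complete model of the Lambek Calculus $\mathrm{L}$ (without modalities). Precisely: - Soundness: for every biclosed poset $M$, every interpretation of the atoms in $\mathsf{Dial}_M(\mathsf{Set})$, and every sequent $A_1,\dots,A_n\vdash B$ derivable in $\mathrm{L}$, there is a morphism $[\![A_1]\!]\otimes\cdots\otimes[\![A_n]\!]\to[\![B]\!]$, where the empty tensor is $I$. - Completeness: if a sequent is valid in this sense in all such models, then it is derivable in $\mathrm{L}$.
   Context: Biclosed poset: a partially ordered monoid $(M,\le,\circ,e)$, not necessarily commutative, with $\circ$ monotone in each argument, in which for all $a,b\in M$ there exist - $a\rightharpoonup b$, the largest $x$ with $a\circ x\le b$; - $b\leftharpoonup a$, the largest $x$ with $x\circ a\le b$. $\mathsf{Dial}_M(\mathsf{Set})$: - Objects are $(U,X,\alpha)$ with $U,X$ sets and $\alpha:U\times X\to M$. - Morphisms $(f,F):(U,X,\alpha)\to(V,Y,\beta)$ are pairs $f:U\to V$, $F:Y\to X$ with $\alpha(u,F(y))\le\beta(f(u),y)$ for all $u,y$. - Composition is $(g,G)\circ(f,F)=(gf,FG)$. Monoidal biclosed structure: - Tensor: $(U,X,\alpha)\otimes(V,Y,\beta)=(U\times V,(V\to X)\times(U\to Y),\alpha\otimes\beta)$ with $(\alpha\otimes\beta)((u,v),(h,k))=\alpha(u,h(v))\circ\beta(k(u),v)$. - Unit: $I=(\mathbb{1},\mathbb{1},e)$. - For $A=(U,X,\alpha)$ and $C=(V,Y,\beta)$,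 $A\rightharpoonup C=((U\to V)\times(Y\to X),U\times Y,\alpha\rightharpoonup\beta)$ with $(\alpha\rightharpoonup\beta)((h,H),(u,y))=\alpha(u,H(y))\rightharpoonup\beta(h(u),y)$. - Likewise $C\leftharpoonup A=((U\to V)\times(Y\to X),U\times Y,\beta\leftharpoonup\alpha)$ with $(\beta\leftharpoonup\alpha)((h,H),(u,y))=\beta(h(u),y)\leftharpoonup\alpha(u,H(y))$. An interpretation assigns an object to each atom and extends to formulas by $[\![I]\!]=I$, $[\![A\otimes B]\!]=[\![A]\!]\otimes[\![B]\!]$, $[\![A\rightharpoonup B]\!]=[\![A]\!]\rightharpoonup[\![B]\!]$, $[\![A\leftharpoonup B]\!]=[\![A]\!]\leftharpoonup[\![B]\!]$. The Lambek Calculus $\mathrm{L}$: formulas are built from atoms, the constant $I$, and the binary connectives $\otimes$, $\rightharpoonup$, $\leftharpoonup$. Sequents are $\Gamma\vdash A$ with $\Gamma$ a finite sequence (not a multiset) of formulas. The rules are: - axiom: $A\vdash A$; - cut: from $\Gamma\vdash A$ and $\Delta_1,A,\Delta_2\vdash B$ infer $\Delta_1,\Gamma,\Delta_2\vdash B$; - $I$-right: $\vdash I$; - $I$-left: from $\Gamma,\Delta\vdash A$ infer $\Gamma,I,\Delta\vdash A$; - $\otimes$-left: from $\Gamma,A,B,\Delta\vdash C$ infer $\Gamma,A\otimes B,\Delta\vdash C$; - $\otimes$-right: from $\Gamma\vdash A$ and $\Delta\vdash B$ infer $\Gamma,\Delta\vdash A\otimes B$; - $\rightharpoonup$-right: from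 $A,\Gamma\vdash B$ infer $\Gamma\vdash A\rightharpoonup B$; - $\rightharpoonup$-left: from $\Gamma\vdash A$ and $\Delta_1,B,\Delta_2\vdash C$ infer $\Delta_1,\Gamma,A\rightharpoonup B,\Delta_2\vdash C$; - $\leftharpoonup$-right: from $\Gamma,B\vdash A$ infer $\Gamma\vdash A\leftharpoonup B$; - $\leftharpoonup$-left: from $\Gamma\vdash B$ and $\Delta_1,A,\Delta_2\vdash C$ infer $\Delta_1,A\leftharpoonup B,\Gamma,\Delta_2\vdash C$. There are no weakening, contraction or exchange rules.
   Formalization: The printed tensor formula α(u,h(v))∘β(k(u),v) is ill-typed, since β : V×Y → M and k : U → Y; it is read as α(u,h(v))∘β(v,k(u)). -}

module Defs where

open import Algebra.Core using (Op₂)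
open import Algebra.Structures using (IsMonoid)
open import Data.List.Base using (List; []; _∷_; [_]; _++_; map)
open import Data.Product.Base using (_×_; _,_)
open import Data.Unit.Polymorphic.Base using (⊤)
open import Level using (Level; _⊔_; suc)
open import Relation.Binary.Core using (Rel)
open import Relation.Binary.Definitions using (LeftMonotonic; RightMonotonic)
open import Relation.Binary.Structures using (IsPartialOrder)

infix 4 _⊢_

-- As in the order-theoretic part of the standard library, antisymmetry and
-- the monoid laws are up to the setoid equality _≈_ of the carrier.
record BiclosedPoset (c ℓ₁ ℓ₂ : Level) : Set (suc (c ⊔ ℓ₁ ⊔ ℓ₂)) where
  infix  4 _≈_ _≤_
  infixl 7 _∘_
  infixr 6 _⇀_
  infixl 6 _↼_
  field
    Carrier        : Set c
    _≈_            : Rel Carrier ℓ₁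
    _≤_            : Rel Carrier ℓ₂
    _∘_            : Op₂ Carrier
    e              : Carrier
    isPartialOrder : IsPartialOrder _≈_ _≤_
    isMonoid       : IsMonoid _≈_ _∘_ e
    ∘-monoˡ        : LeftMonotonic _≤_ _≤_ _∘_
    ∘-monoʳ        : RightMonotonic _≤_ _≤_ _∘_
    _⇀_            : Op₂ Carrier
    ⇀-satisfies    : ∀ a b → a ∘ (a ⇀ b) ≤ b
    ⇀-largest      : ∀ a b x → a ∘ x ≤ b → x ≤ a ⇀ b
    _↼_            : Op₂ Carrier
    ↼-satisfies    : ∀ b a → (b ↼ a) ∘ a ≤ b
    ↼-largest      : ∀ b a x → x ∘ a ≤ b → x ≤ b ↼ a

  open IsPartialOrder isPartialOrder public using (refl; trans; antisym)

module Dial {c ℓ₁ ℓ₂ : Level} (M : BiclosedPoset c ℓ₁ ℓ₂) (s : Level) where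

  open BiclosedPoset M

  infixr 7 _⊗ᴰ_
  infixr 6 _⇀ᴰ_
  infixl 6 _↼ᴰ_
  infixr 9 _∘ᴰ_

  record Obj : Set (c ⊔ suc s) where
    constructor obj
    field
      U : Set s
      X : Set s
      α : U → X → Carrier

  record Hom (A B : Obj) : Set (s ⊔ ℓ₂) where
    constructor hom
    open Obj A
    open Obj B renaming (U to V; X to Y; α to β)
    field
      f   : U → V
      F   : Y → X
      α≤β : ∀ u y → α u (F y) ≤ β (f u) y

  idᴰ : ∀ {A} → Hom A A
  idᴰ = hom (λ u → u) (λ x → x) (λ _ _ → refl)

  _∘ᴰ_ : ∀ {A B C} → Hom B C → Hom A B → Hom A C
  hom g G β≤γ ∘ᴰ hom f F α≤β =
    hom (λ u → g (f u)) (λ z → F (G z)) (λ u z → trans (α≤β u (G z)) (β≤γ (f u) z))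

  Iᴰ : Obj
  Iᴰ = obj ⊤ ⊤ (λ _ _ → e)

  _⊗ᴰ_ : Obj → Obj → Obj
  obj U X α ⊗ᴰ obj V Y β =
    obj (U × V) ((V → X) × (U → Y)) λ (u , v) (h , k) → α u (h v) ∘ β v (k u)

  _⇀ᴰ_ : Obj → Obj → Obj
  obj U X α ⇀ᴰ obj V Y β =
    obj ((U → V) × (Y → X)) (U × Y) λ (h , H) (u , y) → α u (H y) ⇀ β (h u) y

  _↼ᴰ_ : Obj → Obj → Obj
  obj V Y β ↼ᴰ obj U X α =
    obj ((U → V) × (Y → X)) (U × Y) λ (h , H) (u , y) → β (h u) y ↼ α u (H y)

  -- Bracketed to the right, with no trailing unit.
  ⨂ : List Obj → Obj
  ⨂ []           = Iᴰ
  ⨂ (A ∷ [])     = A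
  ⨂ (A ∷ B ∷ As) = A ⊗ᴰ ⨂ (B ∷ As)

data Formula (Atom : Set) : Set where
  atom        : Atom → Formula Atom
  I           : Formula Atom
  _⊗_ _⇀_ _↼_ : Formula Atom → Formula Atom → Formula Atom

infixr 7 _⊗_
infixr 6 _⇀_
infixl 6 _↼_

data _⊢_ {Atom : Set} : List (Formula Atom) → Formula Atom → Set where
  ax  : ∀ {A} → [ A ] ⊢ A
  cut : ∀ {Γ Δ₁ Δ₂ A B} → Γ ⊢ A → Δ₁ ++ A ∷ Δ₂ ⊢ B → Δ₁ ++ Γ ++ Δ₂ ⊢ B
  IR  : [] ⊢ I
  IL  : ∀ {Γ Δ A} → Γ ++ Δ ⊢ A → Γ ++ I ∷ Δ ⊢ A
  ⊗L  : ∀ {Γ Δ A B C} → Γ ++ A ∷ B ∷ Δ ⊢ C → Γ ++ A ⊗ B ∷ Δ ⊢ C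
  ⊗R  : ∀ {Γ Δ A B} → Γ ⊢ A → Δ ⊢ B → Γ ++ Δ ⊢ A ⊗ B
  ⇀R  : ∀ {Γ A B} → A ∷ Γ ⊢ B → Γ ⊢ A ⇀ B
  ⇀L  : ∀ {Γ Δ₁ Δ₂ A B C} → Γ ⊢ A → Δ₁ ++ B ∷ Δ₂ ⊢ C → Δ₁ ++ Γ ++ A ⇀ B ∷ Δ₂ ⊢ C
  ↼R  : ∀ {Γ A B} → Γ ++ [ B ] ⊢ A → Γ ⊢ A ↼ B
  ↼L  : ∀ {Γ Δ₁ Δ₂ A B C} → Γ ⊢ B → Δ₁ ++ A ∷ Δ₂ ⊢ C → Δ₁ ++ A ↼ B ∷ Γ ++ Δ₂ ⊢ C

module Interpretation {c ℓ₁ ℓ₂ : Level} (M : BiclosedPoset c ℓ₁ ℓ₂) (s : Level)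
                      {Atom : Set} (ρ : Atom → Dial.Obj M s) where

  open Dial M s

  ⟦_⟧ : Formula Atom → Obj
  ⟦ atom p ⟧ = ρ p
  ⟦ I ⟧      = Iᴰ
  ⟦ A ⊗ B ⟧  = ⟦ A ⟧ ⊗ᴰ ⟦ B ⟧
  ⟦ A ⇀ B ⟧  = ⟦ A ⟧ ⇀ᴰ ⟦ B ⟧
  ⟦ A ↼ B ⟧  = ⟦ A ⟧ ↼ᴰ ⟦ B ⟧

  Holds : List (Formula Atom) → Formula Atom → Set (s ⊔ ℓ₂)
  Holds Γ B = Hom (⨂ (map ⟦_⟧ Γ)) ⟦ B ⟧

Valid : ∀ c ℓ₁ ℓ₂ s {Atom : Set} → List (Formula Atom) → Formula Atom → Set (suc (c ⊔ ℓ₁ ⊔ ℓ₂ ⊔ s))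
Valid c ℓ₁ ℓ₂ s {Atom} Γ B =
  (M : BiclosedPoset c ℓ₁ ℓ₂) (ρ : Atom → Dial.Obj M s) → Interpretation.Holds M s ρ Γ B

{-# OPTIONS --safe #-}

-- The objects of Dial_M(Set), preordered by the existence of a morphism, are
-- themselves a biclosed poset with operations ⊗ᴰ, ⇀ᴰ, ↼ᴰ, so soundness is the
-- soundness of L in a residuated monoid.  For completeness take M to be the
-- Lindenbaum algebra of L and interpret p as (𝟙, 𝟙, p): every formula A is then
-- interpreted by an object whose relation is constantly A with both sets
-- inhabited, so a morphism ⟦ A ⟧ → ⟦ B ⟧ amounts to a derivation of A ⊢ B.
module Submission where

open import Defs
open import Algebra.Core using (Op₂)
open import Algebra.Structures using (IsMonoid)
open import Data.List.Base using (List; []; _∷_; [_]; _++_; map)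
open import Data.List.Properties using (++-identityʳ)
open import Data.Product.Base using (_×_; _,_; proj₁; proj₂)
open import Data.Unit.Polymorphic.Base using (⊤; tt)
open import Level using (Level; _⊔_; Lift; lift; lower)
open import Relation.Binary.Core using (Rel)
open import Relation.Binary.Construct.Interior.Symmetric using (SymInterior; lhs≤rhs; rhs≤lhs) renaming (_,_ to _,ˢ_)
open import Relation.Binary.Definitions using (LeftMonotonic; Reflexive; RightMonotonic; Transitive)
open import Relation.Binary.PropositionalEquality using (_≡_; cong₂; subst; subst₂) renaming (refl to ≡-refl)
open import Relation.Binary.Structures using (IsPartialOrder)

private
  variable
    c ℓ₁ ℓ₂ s : Level
    Atom : Set

-- Posets and monoids whose equality is mutual inequality

module _
  {A : Set c} {_≤_ : Rel A ℓ₂} (_≈_ : Rel A ℓ₁)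
  (SymInterior⇒≈ : ∀ {x y} → SymInterior _≤_ x y → x ≈ y)
  (≈⇒SymInterior : ∀ {x y} → x ≈ y → SymInterior _≤_ x y)
  (refl : Reflexive _≤_) (trans : Transitive _≤_)
  {_∘_ : Op₂ A} {e : A}
  (monoˡ : LeftMonotonic _≤_ _≤_ _∘_) (monoʳ : RightMonotonic _≤_ _≤_ _∘_)
  (assoc : ∀ x y z → SymInterior _≤_ ((x ∘ y) ∘ z) (x ∘ (y ∘ z)))
  (identityˡ : ∀ x → SymInterior _≤_ (e ∘ x) x)
  (identityʳ : ∀ x → SymInterior _≤_ (x ∘ e) x)
  where

  -- Equality is only assumed logically equivalent to mutual inequality, so the two may live at
  -- different universe levels. Each equality law then reduces to a pair of inequalities.
  symInterior-isPartialOrder : IsPartialOrder _≈_ _≤_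
  symInterior-isPartialOrder = record
    { isPreorder = record
      { isEquivalence = record
        { refl  = SymInterior⇒≈ (refl ,ˢ refl)
        ; sym   = λ p → let (x≤y ,ˢ y≤x) = ≈⇒SymInterior p in SymInterior⇒≈ (y≤x ,ˢ x≤y)
        ; trans = λ p q →
            let (x≤y ,ˢ y≤x) = ≈⇒SymInterior p
                (y≤z ,ˢ z≤y) = ≈⇒SymInterior q
            in SymInterior⇒≈ (trans x≤y y≤z ,ˢ trans z≤y y≤x)
        }
      ; reflexive = λ p → lhs≤rhs (≈⇒SymInterior p)
      ; trans     = trans
      }
    ; antisym = λ x≤y y≤x → SymInterior⇒≈ (x≤y ,ˢ y≤x)
    }

  symInterior-isMonoid : IsMonoid _≈_ _∘_ e
  symInterior-isMonoid = record
    { isSemigroup = record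
      { isMagma = record
        { isEquivalence = IsPartialOrder.isEquivalence symInterior-isPartialOrder
        ; ∙-cong = λ {x} {y} {u} {v} p q →
            let (x≤y ,ˢ y≤x) = ≈⇒SymInterior p
                (u≤v ,ˢ v≤u) = ≈⇒SymInterior q
            in SymInterior⇒≈ (trans (monoˡ x u≤v) (monoʳ v x≤y) ,ˢ trans (monoˡ y v≤u) (monoʳ u y≤x))
        }
      ; assoc = λ x y z → SymInterior⇒≈ (assoc x y z)
      }
    ; identity = (λ x → SymInterior⇒≈ (identityˡ x)) , (λ x → SymInterior⇒≈ (identityʳ x))
    }

-- The biclosed poset of Dial objects

module _ (M : BiclosedPoset c ℓ₁ ℓ₂) (s : Level) where

  open BiclosedPoset M
  open IsPartialOrder isPartialOrder using (reflexive; module Eq)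
  open IsMonoid isMonoid using (assoc; identityˡ; identityʳ)
  open Dial M s

  ⊗ᴰ-monoˡ : LeftMonotonic Hom Hom _⊗ᴰ_
  ⊗ᴰ-monoˡ A (hom g G β≤γ) = hom
    (λ (u , v) → u , g v)
    (λ (h , k) → (λ v → h (g v)) , (λ u → G (k u)))
    (λ (u , v) (h , k) → ∘-monoˡ _ (β≤γ v (k u)))

  ⊗ᴰ-monoʳ : RightMonotonic Hom Hom _⊗ᴰ_
  ⊗ᴰ-monoʳ A (hom f F α≤β) = hom
    (λ (u , v) → f u , v)
    (λ (h , k) → (λ v → F (h v)) , (λ u → k (f u)))
    (λ (u , v) (h , k) → ∘-monoʳ _ (α≤β u (h v)))

  -- For `A`, `B`, `C` on sets `(U, X)`, `(V, Y)`, `(W, Z)`, the second set on either side is, up to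
  -- currying, the triples of maps `V × W → X`, `U × W → Y`, `U × V → Z`. The backward maps only
  -- recurry these.
  ⊗ᴰ-assoc : ∀ A B C → SymInterior Hom ((A ⊗ᴰ B) ⊗ᴰ C) (A ⊗ᴰ (B ⊗ᴰ C))
  ⊗ᴰ-assoc A B C =
    hom
      (λ ((u , v) , w) → u , (v , w))
      (λ (h , k) → (λ w → (λ v → h (v , w)) , (λ u → proj₁ (k u) w)) , (λ (u , v) → proj₂ (k u) v))
      (λ _ _ → reflexive (assoc _ _ _))
    ,ˢ
    hom
      (λ (u , (v , w)) → (u , v) , w)
      (λ (h , k) → (λ (v , w) → proj₁ (h w) v) , (λ u → (λ w → proj₂ (h w) u) , (λ v → k (u , v))))
      (λ _ _ → reflexive (Eq.sym (assoc _ _ _)))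

  ⊗ᴰ-identityˡ : ∀ A → SymInterior Hom (Iᴰ ⊗ᴰ A) A
  ⊗ᴰ-identityˡ A =
    hom proj₂ (λ x → (λ _ → tt) , (λ _ → x)) (λ _ _ → reflexive (identityˡ _))
    ,ˢ
    hom (tt ,_) (λ (h , k) → k tt) (λ _ _ → reflexive (Eq.sym (identityˡ _)))

  ⊗ᴰ-identityʳ : ∀ A → SymInterior Hom (A ⊗ᴰ Iᴰ) A
  ⊗ᴰ-identityʳ A =
    hom proj₁ (λ x → (λ _ → x) , (λ _ → tt)) (λ _ _ → reflexive (identityʳ _))
    ,ˢ
    hom (_, tt) (λ (h , k) → h tt) (λ _ _ → reflexive (Eq.sym (identityʳ _)))

  -- The backward map is chosen so that both tensor factors see the same value `α u (H y)`, which
  -- leaves an instance of modus ponens in `M`.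
  ⇀ᴰ-eval : ∀ A B → Hom (A ⊗ᴰ (A ⇀ᴰ B)) B
  ⇀ᴰ-eval A B = hom
    (λ (u , (h , H)) → h u)
    (λ y → (λ (h , H) → H y) , (λ u → u , y))
    (λ _ _ → ⇀-satisfies _ _)

  -- With `C` on `(W, Z)`, the given backward map `Y → (W → X) × (U → Z)` splits in two: its first
  -- half, at `w`, is the contravariant part of an element of `A ⇀ᴰ B`, and its second half,
  -- uncurried, is the new backward map.
  ⇀ᴰ-curry : ∀ A B C → Hom (A ⊗ᴰ C) B → Hom C (A ⇀ᴰ B)
  ⇀ᴰ-curry A B C (hom f F p) = hom
    (λ w → (λ u → f (u , w)) , (λ y → proj₁ (F y) w))
    (λ (u , y) → proj₂ (F y) u)
    (λ w (u , y) → ⇀-largest _ _ _ (p (u , w) y))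

  ↼ᴰ-eval : ∀ B A → Hom ((B ↼ᴰ A) ⊗ᴰ A) B
  ↼ᴰ-eval B A = hom
    (λ ((h , H) , u) → h u)
    (λ y → (λ u → u , y) , (λ (h , H) → H y))
    (λ _ _ → ↼-satisfies _ _)

  ↼ᴰ-curry : ∀ B A C → Hom (C ⊗ᴰ A) B → Hom C (B ↼ᴰ A)
  ↼ᴰ-curry B A C (hom f F p) = hom
    (λ w → (λ u → f (w , u)) , (λ y → proj₂ (F y) w))
    (λ (u , y) → proj₁ (F y) u)
    (λ w (u , y) → ↼-largest _ _ _ (p (w , u) y))

  private
    homTrans : Transitive Hom
    homTrans p q = q ∘ᴰ p

  -- Equality of objects is the existence of morphisms both ways, which is weaker than isomorphism
  -- and makes antisymmetry immediate.
  Dial-biclosedPoset : BiclosedPoset (c ⊔ Level.suc s) (s ⊔ ℓ₂) (s ⊔ ℓ₂)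
  Dial-biclosedPoset = record
    { Carrier        = Obj
    ; _≈_            = SymInterior Hom
    ; _≤_            = Hom
    ; _∘_            = _⊗ᴰ_
    ; e              = Iᴰ
    ; isPartialOrder = symInterior-isPartialOrder (SymInterior Hom) (λ p → p) (λ p → p) idᴰ homTrans
                         ⊗ᴰ-monoˡ ⊗ᴰ-monoʳ ⊗ᴰ-assoc ⊗ᴰ-identityˡ ⊗ᴰ-identityʳ
    ; isMonoid       = symInterior-isMonoid (SymInterior Hom) (λ p → p) (λ p → p) idᴰ homTrans
                         ⊗ᴰ-monoˡ ⊗ᴰ-monoʳ ⊗ᴰ-assoc ⊗ᴰ-identityˡ ⊗ᴰ-identityʳ
    ; ∘-monoˡ        = ⊗ᴰ-monoˡ
    ; ∘-monoʳ        = ⊗ᴰ-monoʳ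
    ; _⇀_            = _⇀ᴰ_
    ; ⇀-satisfies    = ⇀ᴰ-eval
    ; ⇀-largest      = ⇀ᴰ-curry
    ; _↼_            = _↼ᴰ_
    ; ↼-satisfies    = ↼ᴰ-eval
    ; ↼-largest      = ↼ᴰ-curry
    }

-- Soundness

module ListProduct (N : BiclosedPoset c ℓ₁ ℓ₂) {F : Set} (v : F → BiclosedPoset.Carrier N) where

  open BiclosedPoset N
  open IsPartialOrder isPartialOrder using (reflexive; module Eq)
  open IsMonoid isMonoid using (assoc; identityˡ; ∙-congˡ)

  -- Unlike `⨂`, this ends in `e` even on nonempty lists, so it splits over concatenation without a
  -- case distinction on emptiness.
  ∏ : List F → Carrier
  ∏ []      = e
  ∏ (A ∷ Γ) = v A ∘ ∏ Γ

  ∏-++ : ∀ Γ Δ → ∏ (Γ ++ Δ) ≈ ∏ Γ ∘ ∏ Δ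
  ∏-++ []      Δ = Eq.sym (identityˡ _)
  ∏-++ (A ∷ Γ) Δ = Eq.trans (∙-congˡ (∏-++ Γ Δ)) (Eq.sym (assoc _ _ _))

  ∏-++-≤ : ∀ Γ Δ → ∏ (Γ ++ Δ) ≤ ∏ Γ ∘ ∏ Δ
  ∏-++-≤ Γ Δ = reflexive (∏-++ Γ Δ)

  ∏-++-≥ : ∀ Γ Δ → ∏ Γ ∘ ∏ Δ ≤ ∏ (Γ ++ Δ)
  ∏-++-≥ Γ Δ = reflexive (Eq.sym (∏-++ Γ Δ))

  ∏-++-monoʳ : ∀ Δ {Γ Γ′} → ∏ Γ ≤ ∏ Γ′ → ∏ (Δ ++ Γ) ≤ ∏ (Δ ++ Γ′)
  ∏-++-monoʳ []      p = p
  ∏-++-monoʳ (A ∷ Δ) p = ∘-monoˡ _ (∏-++-monoʳ Δ p)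

  -- For `x = v B` the bound is `∏ (B ∷ Δ)` by definition, which is how a premise `Γ ⊢ B` lets one
  -- formula stand for a block of context.
  ∏-++-replace : ∀ Γ Δ {x} → ∏ Γ ≤ x → ∏ (Γ ++ Δ) ≤ x ∘ ∏ Δ
  ∏-++-replace Γ Δ p = trans (∏-++-≤ Γ Δ) (∘-monoʳ _ p)

module ResiduatedSoundness (N : BiclosedPoset c ℓ₁ ℓ₂) (ρ : Atom → BiclosedPoset.Carrier N) where

  open BiclosedPoset N renaming (_⇀_ to _⇀ᴺ_; _↼_ to _↼ᴺ_)
  open IsPartialOrder isPartialOrder using (reflexive; module Eq)
  open IsMonoid isMonoid using (assoc; identityˡ; identityʳ)

  ⟦_⟧ᴺ : Formula Atom → Carrier
  ⟦ atom p ⟧ᴺ = ρ p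
  ⟦ I ⟧ᴺ      = e
  ⟦ A ⊗ B ⟧ᴺ  = ⟦ A ⟧ᴺ ∘ ⟦ B ⟧ᴺ
  ⟦ A ⇀ B ⟧ᴺ  = ⟦ A ⟧ᴺ ⇀ᴺ ⟦ B ⟧ᴺ
  ⟦ A ↼ B ⟧ᴺ  = ⟦ A ⟧ᴺ ↼ᴺ ⟦ B ⟧ᴺ

  open ListProduct N ⟦_⟧ᴺ public

  ∏-sound : ∀ {Γ B} → Γ ⊢ B → ∏ Γ ≤ ⟦ B ⟧ᴺ
  ∏-sound ax = reflexive (identityʳ _)
  ∏-sound (cut {Γ} {Δ₁} {Δ₂} p q) =
    trans (∏-++-monoʳ Δ₁ (∏-++-replace Γ Δ₂ (∏-sound p))) (∏-sound q)
  ∏-sound IR = refl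
  ∏-sound (IL {Γ} p) = trans (∏-++-monoʳ Γ (reflexive (identityˡ _))) (∏-sound p)
  ∏-sound (⊗L {Γ} p) = trans (∏-++-monoʳ Γ (reflexive (assoc _ _ _))) (∏-sound p)
  ∏-sound (⊗R {Γ} {Δ} p q) = trans (∏-++-replace Γ Δ (∏-sound p)) (∘-monoˡ _ (∏-sound q))
  ∏-sound (⇀R p) = ⇀-largest _ _ _ (∏-sound p)
  ∏-sound (⇀L {Γ} {Δ₁} {Δ₂} p q) =
    trans (∏-++-monoʳ Δ₁
      -- Bounding `Γ` by `A` leaves `A ∘ ((A ⇀ B) ∘ ∏ Δ₂)`; reassociating exposes `A ∘ (A ⇀ B) ≤ B`.
      (trans (∏-++-replace Γ _ (∏-sound p))
        (trans (reflexive (Eq.sym (assoc _ _ _))) (∘-monoʳ _ (⇀-satisfies _ _)))))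
      (∏-sound q)
  ∏-sound (↼R {Γ} {A} {B} p) = ↼-largest _ _ _
    -- `∏ [ B ]` is `⟦ B ⟧ᴺ ∘ e`, so a trailing unit is inserted before the two lists are joined.
    (trans (∘-monoˡ _ (reflexive (Eq.sym (identityʳ _))))
      (trans (∏-++-≥ Γ [ B ]) (∏-sound p)))
  ∏-sound (↼L {Γ} {Δ₁} {Δ₂} p q) =
    trans (∏-++-monoʳ Δ₁
      (trans (∘-monoˡ _ (∏-++-replace Γ Δ₂ (∏-sound p)))
        (trans (reflexive (Eq.sym (assoc _ _ _))) (∘-monoʳ _ (↼-satisfies _ _)))))
      (∏-sound q)

module Soundness (M : BiclosedPoset c ℓ₁ ℓ₂) (s : Level) (ρ : Atom → Dial.Obj M s) where

  open Dial M s
  open Interpretation M s ρ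
  open ResiduatedSoundness (Dial-biclosedPoset M s) ρ

  -- The two interpretations are separate recursions with matching clauses, so on a variable formula
  -- they agree only by induction.
  ⟦⟧ᴺ≡⟦⟧ : ∀ A → ⟦ A ⟧ᴺ ≡ ⟦ A ⟧
  ⟦⟧ᴺ≡⟦⟧ (atom p) = ≡-refl
  ⟦⟧ᴺ≡⟦⟧ I        = ≡-refl
  ⟦⟧ᴺ≡⟦⟧ (A ⊗ B)  = cong₂ _⊗ᴰ_ (⟦⟧ᴺ≡⟦⟧ A) (⟦⟧ᴺ≡⟦⟧ B)
  ⟦⟧ᴺ≡⟦⟧ (A ⇀ B)  = cong₂ _⇀ᴰ_ (⟦⟧ᴺ≡⟦⟧ A) (⟦⟧ᴺ≡⟦⟧ B)
  ⟦⟧ᴺ≡⟦⟧ (A ↼ B)  = cong₂ _↼ᴰ_ (⟦⟧ᴺ≡⟦⟧ A) (⟦⟧ᴺ≡⟦⟧ B)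

  -- Appends the trailing unit that `∏` has and `⨂` lacks; the work is at the one-element list.
  ⨂⇒∏ : ∀ Γ → Hom (⨂ (map ⟦_⟧ Γ)) (∏ Γ)
  ⨂⇒∏ []          = idᴰ
  ⨂⇒∏ (A ∷ [])    rewrite ⟦⟧ᴺ≡⟦⟧ A = rhs≤lhs (⊗ᴰ-identityʳ M s ⟦ A ⟧)
  ⨂⇒∏ (A ∷ B ∷ Γ) with m ← ⨂⇒∏ (B ∷ Γ) rewrite ⟦⟧ᴺ≡⟦⟧ A = ⊗ᴰ-monoˡ M s ⟦ A ⟧ m

  sound : ∀ {Γ B} → Γ ⊢ B → Holds Γ B
  sound {Γ} {B} p = subst (Hom _) (⟦⟧ᴺ≡⟦⟧ B) (∏-sound p ∘ᴰ ⨂⇒∏ Γ)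

-- Objects with constant relation

module _ (M : BiclosedPoset c ℓ₁ ℓ₂) (s : Level) where

  open BiclosedPoset M renaming (_⇀_ to _⇀ᴹ_; _↼_ to _↼ᴹ_)
  open Dial M s

  -- The points serve twice: constant functions at them inhabit the function sets of the
  -- connectives, and a morphism's inequality can be evaluated at them. Propositional equality
  -- passes through the residuals by plain congruence.
  record Constant (A : Obj) (a : Carrier) : Set (c ⊔ s) where
    constructor constant
    open Obj A
    field
      u₀  : U
      x₀  : X
      α≡a : ∀ u x → α u x ≡ a

  private
    variable
      A B : Obj
      a b : Carrier

  Iᴰ-constant : Constant Iᴰ e
  Iᴰ-constant = constant tt tt (λ _ _ → ≡-refl)

  ⊗ᴰ-constant : Constant A a → Constant B b → Constant (A ⊗ᴰ B) (a ∘ b)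
  ⊗ᴰ-constant (constant u x p) (constant v y q) = constant
    (u , v) ((λ _ → x) , (λ _ → y)) (λ _ _ → cong₂ _∘_ (p _ _) (q _ _))

  ⇀ᴰ-constant : Constant A a → Constant B b → Constant (A ⇀ᴰ B) (a ⇀ᴹ b)
  ⇀ᴰ-constant (constant u x p) (constant v y q) = constant
    ((λ _ → v) , (λ _ → x)) (u , y) (λ _ _ → cong₂ _⇀ᴹ_ (p _ _) (q _ _))

  ↼ᴰ-constant : Constant B b → Constant A a → Constant (B ↼ᴰ A) (b ↼ᴹ a)
  ↼ᴰ-constant (constant v y q) (constant u x p) = constant
    ((λ _ → v) , (λ _ → x)) (u , y) (λ _ _ → cong₂ _↼ᴹ_ (q _ _) (p _ _))

  constant-reflects-≤ : Constant A a → Constant B b → Hom A B → a ≤ b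
  constant-reflects-≤ (constant u _ p) (constant _ y q) (hom f F α≤β) =
    subst₂ _≤_ (p _ _) (q _ _) (α≤β u y)

-- Completeness

⊢-trans : ∀ {Γ} {A B : Formula Atom} → Γ ⊢ A → [ A ] ⊢ B → Γ ⊢ B
⊢-trans {Γ = Γ} p q = subst (_⊢ _) (++-identityʳ Γ) (cut {Δ₁ = []} {Δ₂ = []} p q)

⊗L₂ : {A B C : Formula Atom} → A ∷ B ∷ [] ⊢ C → [ A ⊗ B ] ⊢ C
⊗L₂ = ⊗L {Γ = []} {Δ = []}

⊗-assoc : (A B C : Formula Atom) →
  SymInterior (λ A B → [ A ] ⊢ B) ((A ⊗ B) ⊗ C) (A ⊗ (B ⊗ C))
⊗-assoc A B C =
  ⊗L₂ (⊗L {Γ = []} {Δ = [ C ]} (⊗R ax (⊗R ax ax))) ,ˢ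
  ⊗L₂ (⊗L {Γ = [ A ]} {Δ = []} (⊗R (⊗R ax ax) ax))

⊗-identityˡ : (A : Formula Atom) → SymInterior (λ A B → [ A ] ⊢ B) (I ⊗ A) A
⊗-identityˡ A = ⊗L₂ (IL {Γ = []} ax) ,ˢ ⊗R IR ax

⊗-identityʳ : (A : Formula Atom) → SymInterior (λ A B → [ A ] ⊢ B) (A ⊗ I) A
⊗-identityʳ A = ⊗L₂ (IL {Γ = [ A ]} ax) ,ˢ ⊗R ax IR

module Lindenbaum (Atom : Set) (c ℓ₁ ℓ₂ : Level) where

  private
    infix 4 _≤_ _≈_

    -- The lifts place the syntax at the arbitrary levels for which validity is assumed.
    F : Set c
    F = Lift c (Formula Atom)

    _≤_ : Rel F ℓ₂
    lift A ≤ lift B = Lift ℓ₂ ([ A ] ⊢ B)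

    _≈_ : Rel F ℓ₁
    lift A ≈ lift B = Lift ℓ₁ (SymInterior (λ A B → [ A ] ⊢ B) A B)

    SymInterior⇒≈ : ∀ {x y} → SymInterior _≤_ x y → x ≈ y
    SymInterior⇒≈ (lift p ,ˢ lift q) = lift (p ,ˢ q)

    lift-SymInterior : ∀ {A B} → SymInterior (λ A B → [ A ] ⊢ B) A B → SymInterior _≤_ (lift A) (lift B)
    lift-SymInterior (p ,ˢ q) = lift p ,ˢ lift q

    ≈⇒SymInterior : ∀ {x y} → x ≈ y → SymInterior _≤_ x y
    ≈⇒SymInterior (lift p) = lift-SymInterior p

    ≤-trans : Transitive _≤_
    ≤-trans (lift p) (lift q) = lift (⊢-trans p q)

    _∘_ : Op₂ F
    lift A ∘ lift B = lift (A ⊗ B)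

    ∘-monoˡ : LeftMonotonic _≤_ _≤_ _∘_
    ∘-monoˡ _ (lift p) = lift (⊗L₂ (⊗R ax p))

    ∘-monoʳ : RightMonotonic _≤_ _≤_ _∘_
    ∘-monoʳ _ (lift p) = lift (⊗L₂ (⊗R p ax))

  lindenbaum : BiclosedPoset c ℓ₁ ℓ₂
  lindenbaum = record
    { Carrier        = F
    ; _≈_            = _≈_
    ; _≤_            = _≤_
    ; _∘_            = _∘_
    ; e              = lift I
    ; isPartialOrder = symInterior-isPartialOrder _≈_ SymInterior⇒≈ ≈⇒SymInterior (lift ax) ≤-trans
                         ∘-monoˡ ∘-monoʳ
                         (λ (lift A) (lift B) (lift C) → lift-SymInterior (⊗-assoc A B C))
                         (λ (lift A) → lift-SymInterior (⊗-identityˡ A))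
                         (λ (lift A) → lift-SymInterior (⊗-identityʳ A))
    ; isMonoid       = symInterior-isMonoid _≈_ SymInterior⇒≈ ≈⇒SymInterior (lift ax) ≤-trans
                         ∘-monoˡ ∘-monoʳ
                         (λ (lift A) (lift B) (lift C) → lift-SymInterior (⊗-assoc A B C))
                         (λ (lift A) → lift-SymInterior (⊗-identityˡ A))
                         (λ (lift A) → lift-SymInterior (⊗-identityʳ A))
    ; ∘-monoˡ        = ∘-monoˡ
    ; ∘-monoʳ        = ∘-monoʳ
    ; _⇀_            = λ (lift A) (lift B) → lift (A ⇀ B)
    ; ⇀-satisfies    = λ _ _ → lift (⊗L₂ (⇀L {Δ₁ = []} {Δ₂ = []} ax ax))
    -- Cutting with `A, X ⊢ A ⊗ X` inverts `⊗L`, which gives a premise of the shape `⇀R` takes.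
    ; ⇀-largest      = λ _ _ _ (lift p) → lift (⇀R (⊢-trans (⊗R ax ax) p))
    ; _↼_            = λ (lift B) (lift A) → lift (B ↼ A)
    ; ↼-satisfies    = λ _ _ → lift (⊗L₂ (↼L {Δ₁ = []} {Δ₂ = []} ax ax))
    ; ↼-largest      = λ _ _ _ (lift p) → lift (↼R (⊢-trans (⊗R ax ax) p))
    }

-- Bracketed exactly like `⨂`, so the interpreted context is constantly this very formula.
⨂ᶠ : List (Formula Atom) → Formula Atom
⨂ᶠ []          = I
⨂ᶠ (A ∷ [])    = A
⨂ᶠ (A ∷ B ∷ Γ) = A ⊗ ⨂ᶠ (B ∷ Γ)

⊢⨂ᶠ : (Γ : List (Formula Atom)) → Γ ⊢ ⨂ᶠ Γ
⊢⨂ᶠ []          = IR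
⊢⨂ᶠ (A ∷ [])    = ax
⊢⨂ᶠ (A ∷ B ∷ Γ) = ⊗R ax (⊢⨂ᶠ (B ∷ Γ))

module Completeness (Atom : Set) (c ℓ₁ ℓ₂ s : Level) where

  open Lindenbaum Atom c ℓ₁ ℓ₂
  open Dial lindenbaum s

  canonical : Atom → Obj
  canonical p = obj ⊤ ⊤ (λ _ _ → lift (atom p))

  open Interpretation lindenbaum s canonical

  -- The operations of `lindenbaum` compute to the connectives themselves, so the constant value is
  -- `A` on the nose.
  ⟦⟧-constant : ∀ A → Constant lindenbaum s ⟦ A ⟧ (lift A)
  ⟦⟧-constant (atom p) = constant tt tt (λ _ _ → ≡-refl)
  ⟦⟧-constant I        = Iᴰ-constant lindenbaum s
  ⟦⟧-constant (A ⊗ B)  = ⊗ᴰ-constant lindenbaum s (⟦⟧-constant A) (⟦⟧-constant B)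
  ⟦⟧-constant (A ⇀ B)  = ⇀ᴰ-constant lindenbaum s (⟦⟧-constant A) (⟦⟧-constant B)
  ⟦⟧-constant (A ↼ B)  = ↼ᴰ-constant lindenbaum s (⟦⟧-constant A) (⟦⟧-constant B)

  ⨂-constant : ∀ Γ → Constant lindenbaum s (⨂ (map ⟦_⟧ Γ)) (lift (⨂ᶠ Γ))
  ⨂-constant []          = Iᴰ-constant lindenbaum s
  ⨂-constant (A ∷ [])    = ⟦⟧-constant A
  ⨂-constant (A ∷ B ∷ Γ) = ⊗ᴰ-constant lindenbaum s (⟦⟧-constant A) (⨂-constant (B ∷ Γ))

  complete : ∀ {Γ B} → Holds Γ B → Γ ⊢ B
  complete {Γ} {B} m = ⊢-trans (⊢⨂ᶠ Γ)
    (lower (constant-reflects-≤ lindenbaum s (⨂-constant Γ) (⟦⟧-constant B) m))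

theorem1 : ∀ {c ℓ₁ ℓ₂ s} (Atom : Set) (Γ : List (Formula Atom)) (B : Formula Atom) →
    (Γ ⊢ B → Valid c ℓ₁ ℓ₂ s Γ B) × (Valid c ℓ₁ ℓ₂ s Γ B → Γ ⊢ B)
theorem1 {c} {ℓ₁} {ℓ₂} {s} Atom Γ B =
  (λ p M ρ → Soundness.sound M s ρ p) ,
  -- One model, independent of `Γ` and `B`, refutes every underivable sequent.
  (λ valid → complete (valid lindenbaum canonical))
  where
  open Lindenbaum Atom c ℓ₁ ℓ₂
  open Completeness Atom c ℓ₁ ℓ₂ s
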